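{- For all $\epsilon\in (0,1)$ and all integers $k\geq 2$, there is $p_0=p_0(k,\epsilon)$ such that the following holds. Suppose that $G=\mathbb{Z}/p\mathbb{Z}$ is a cyclic group of prime order $p\geq p_0$, and that $A\subseteq G$ is $k$-stable. Then either $|A|\leq \epsilon|G|$, or $|G\setminus A|\leq \epsilon|G|$.
   Context: Stability: for a group $G$ (written additively), $A\subseteq G$ and an integer $k\geq 2$, the set $A$ has the $k$-order property if there exist $a_1,\dots,a_k,b_1,\dots,b_k\in G$ such that $a_i+b_j\in A$ if and only if $i\leq j$. The set $A$ is $k$-stable if it does not have the $k$-order property. -}

module Defs where

open import Algebra.Bundles using (Group; AbelianGroup)
open import Algebra.Structures using (IsMonoid)
open import Data.Fin.Base as Fin using (Fin; toℕ)
open import Data.Fin.Properties using (toℕ-fromℕ<; toℕ-injective; toℕ<n; toℕ≤n)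
open import Data.Fin.Subset using (Subset; ∣_∣)
open import Data.Integer.Base using (+_)
open import Data.Nat.Base as ℕ using (ℕ; NonZero; _∸_; _%_)
open import Data.Nat.DivMod using (_mod_; m%n<n; %-distribˡ-+; m%n%n≡m%n; m<n⇒m%n≡m; n%n≡0)
import Data.Nat.Properties as ℕ
open import Data.Product.Base using (_×_; _,_; ∃; ∃-syntax; Σ-syntax)
open import Data.Rational.Base as ℚ using (ℚ; 0ℚ; 1ℚ; _/_)
import Data.Rational.Properties as ℚ
open import Data.Sum.Base using (_⊎_; inj₁; inj₂)
open import Function.Bundles using (_⇔_; mk⇔)
open import Level using (Level; _⊔_; 0ℓ)
open import Relation.Binary.Definitions using (tri<; tri≈; tri>)
open import Relation.Binary.PropositionalEquality
open import Relation.Nullary.Negation.Core using (¬_)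
open import Relation.Unary using (Pred)

-- Dedekind reals: two-sided located cuts of the rationals.

record ℝ : Set₁ where
  field
    Lower Upper     : Pred ℚ 0ℓ
    lower-inhabited : ∃ Lower
    upper-inhabited : ∃ Upper
    lower-rounded   : ∀ q → Lower q ⇔ (∃[ r ] q ℚ.< r × Lower r)
    upper-rounded   : ∀ r → Upper r ⇔ (∃[ q ] q ℚ.< r × Upper q)
    disjoint        : ∀ q → ¬ (Lower q × Upper q)
    located         : ∀ q r → q ℚ.< r → Lower q ⊎ Upper r

open ℝ

infix 4 _<_ _≤_

_<_ : ℝ → ℝ → Set
x < y = ∃[ q ] Upper x q × Lower y q

_≤_ : ℝ → ℝ → Set
x ≤ y = ¬ (y < x)

fromℚ : ℚ → ℝ
fromℚ x = record
  { Lower           = ℚ._< x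
  ; Upper           = x ℚ.<_
  ; lower-inhabited = x ℚ.- 1ℚ , subst (x ℚ.- 1ℚ ℚ.<_) (ℚ.+-identityʳ x) (ℚ.+-monoʳ-< x (ℚ.negative⁻¹ (ℚ.- 1ℚ)))
  ; upper-inhabited = x ℚ.+ 1ℚ , subst (ℚ._< x ℚ.+ 1ℚ) (ℚ.+-identityʳ x) (ℚ.+-monoʳ-< x (ℚ.positive⁻¹ 1ℚ))
  ; lower-rounded   = λ q → mk⇔ ℚ.<-dense (λ (r , q<r , r<x) → ℚ.<-trans q<r r<x)
  ; upper-rounded   = λ r → mk⇔ (λ x<r → let (q , x<q , q<r) = ℚ.<-dense x<r in q , q<r , x<q)
                                (λ (q , q<r , x<q) → ℚ.<-trans x<q q<r)
  ; disjoint        = λ q (q<x , x<q) → ℚ.<-asym q<x x<q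
  ; located         = loc
  }
  where
  loc : ∀ q r → q ℚ.< r → q ℚ.< x ⊎ x ℚ.< r
  loc q r q<r with ℚ.<-cmp q x
  ... | tri< q<x _ _  = inj₁ q<x
  ... | tri≈ _ refl _ = inj₂ q<r
  ... | tri> _ _ x<q  = inj₂ (ℚ.<-trans x<q q<r)

0ℝ 1ℝ : ℝ
0ℝ = fromℚ 0ℚ
1ℝ = fromℚ 1ℚ

module _ {c ℓ a : Level} (G : Group c ℓ) where
  open Group G using (Carrier) renaming (_∙_ to _+_)

  HasOrderProperty : ℕ → Pred Carrier a → Set (c ⊔ a)
  HasOrderProperty k A =
    Σ[ x ∈ (Fin k → Carrier) ] Σ[ y ∈ (Fin k → Carrier) ] ∀ (i j : Fin k) → A (x i + y j) ⇔ i Fin.≤ j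

  Stable : ℕ → Pred Carrier a → Set (c ⊔ a)
  Stable k A = ¬ HasOrderProperty k A

-- The group of residues 0, …, n - 1 under addition modulo n.

module _ (n : ℕ) .{{_ : NonZero n}} where

  infixl 6 _⊕_

  _⊕_ : Fin n → Fin n → Fin n
  i ⊕ j = (toℕ i ℕ.+ toℕ j) mod n

  𝟘 : Fin n
  𝟘 = 0 mod n

  ⊖_ : Fin n → Fin n
  ⊖ i = (n ∸ toℕ i) mod n

  private
    open ≡-Reasoning

    toℕ-mod : ∀ m → toℕ (m mod n) ≡ m % n
    toℕ-mod m = toℕ-fromℕ< (m%n<n m n)

    toℕ-% : ∀ (i : Fin n) → toℕ i % n ≡ toℕ i
    toℕ-% i = m<n⇒m%n≡m (toℕ<n i)

    %-absorbˡ : ∀ a b → (a % n ℕ.+ b) % n ≡ (a ℕ.+ b) % n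
    %-absorbˡ a b = begin
      (a % n ℕ.+ b) % n           ≡⟨ %-distribˡ-+ (a % n) b n ⟩
      (a % n % n ℕ.+ b % n) % n   ≡⟨ cong (λ t → (t ℕ.+ b % n) % n) (m%n%n≡m%n a n) ⟩
      (a % n ℕ.+ b % n) % n       ≡⟨ %-distribˡ-+ a b n ⟨
      (a ℕ.+ b) % n               ∎

    ⊕-comm : ∀ i j → i ⊕ j ≡ j ⊕ i
    ⊕-comm i j = cong (_mod n) (ℕ.+-comm (toℕ i) (toℕ j))

    toℕ-⊕ˡ : ∀ m j → toℕ (m mod n ⊕ j) ≡ (m ℕ.+ toℕ j) % n
    toℕ-⊕ˡ m j = begin
      toℕ (m mod n ⊕ j)               ≡⟨ toℕ-mod _ ⟩
      (toℕ (m mod n) ℕ.+ toℕ j) % n   ≡⟨ cong (λ t → (t ℕ.+ toℕ j) % n) (toℕ-mod m) ⟩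
      (m % n ℕ.+ toℕ j) % n           ≡⟨ %-absorbˡ m (toℕ j) ⟩
      (m ℕ.+ toℕ j) % n               ∎

    ⊕-assoc : ∀ i j k → (i ⊕ j) ⊕ k ≡ i ⊕ (j ⊕ k)
    ⊕-assoc i j k = toℕ-injective (begin
      toℕ ((i ⊕ j) ⊕ k)                      ≡⟨ toℕ-⊕ˡ (toℕ i ℕ.+ toℕ j) k ⟩
      (toℕ i ℕ.+ toℕ j ℕ.+ toℕ k) % n        ≡⟨ cong (_% n) (ℕ.+-assoc (toℕ i) (toℕ j) (toℕ k)) ⟩
      (toℕ i ℕ.+ (toℕ j ℕ.+ toℕ k)) % n      ≡⟨ cong (_% n) (ℕ.+-comm (toℕ i) (toℕ j ℕ.+ toℕ k)) ⟩
      (toℕ j ℕ.+ toℕ k ℕ.+ toℕ i) % n        ≡⟨ toℕ-⊕ˡ (toℕ j ℕ.+ toℕ k) i ⟨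
      toℕ ((j ⊕ k) ⊕ i)                      ≡⟨ cong toℕ (⊕-comm (j ⊕ k) i) ⟩
      toℕ (i ⊕ (j ⊕ k))                      ∎)

    ⊕-identityˡ : ∀ i → 𝟘 ⊕ i ≡ i
    ⊕-identityˡ i = toℕ-injective (trans (toℕ-⊕ˡ 0 i) (toℕ-% i))

    ⊕-inverseˡ : ∀ i → ⊖ i ⊕ i ≡ 𝟘
    ⊕-inverseˡ i = toℕ-injective (begin
      toℕ (⊖ i ⊕ i)                    ≡⟨ toℕ-⊕ˡ (n ∸ toℕ i) i ⟩
      (n ∸ toℕ i ℕ.+ toℕ i) % n        ≡⟨ cong (_% n) (ℕ.m∸n+n≡m (toℕ≤n i)) ⟩
      n % n                            ≡⟨ n%n≡0 n ⟩
      0                                ≡⟨ m<n⇒m%n≡m (ℕ.>-nonZero⁻¹ n) ⟨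
      0 % n                            ≡⟨ toℕ-mod 0 ⟨
      toℕ 𝟘                            ∎)

    isMonoid : IsMonoid _≡_ _⊕_ 𝟘
    isMonoid = record
      { isSemigroup = record
        { isMagma = record { isEquivalence = isEquivalence ; ∙-cong = cong₂ _⊕_ }
        ; assoc   = ⊕-assoc
        }
      ; identity = ⊕-identityˡ , λ i → trans (⊕-comm i 𝟘) (⊕-identityˡ i)
      }

  ℤ/ : AbelianGroup 0ℓ 0ℓ
  ℤ/ = record
    { Carrier        = Fin n
    ; _≈_            = _≡_
    ; _∙_            = _⊕_
    ; ε              = 𝟘
    ; _⁻¹            = ⊖_
    ; isAbelianGroup = record
      { isGroup = record
        { isMonoid = isMonoid
        ; inverse  = ⊕-inverseˡ , λ i → trans (⊕-comm i (⊖ i)) (⊕-inverseˡ i)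
        ; ⁻¹-cong  = cong ⊖_
        }
      ; comm = ⊕-comm
      }
    }

-- ∣ A ∣ ≤ ε n is expressed as density A ≤ ε, which avoids multiplication of reals.

density : ∀ {n : ℕ} .{{_ : NonZero n}} → Subset n → ℝ
density {n} A = fromℚ (+ ∣ A ∣ / n)

{-# OPTIONS --safe #-}

-- Averages of A over the translates of a large set X cannot all be close to 0 or 1 unless A is
-- trivial: if they are, call X good. Some nonzero d has X ∩ (X − d) so large that the averages over
-- X + b and X + b + d cannot lie at opposite ends; since d generates ℤ/p, all averages
-- lie at the same end, and double counting bounds the density of A or of its complement.
--
-- A good X exists by stability. If a set is not good, some translate A − b splits it into two
-- large parts; repeating this for each part builds a full binary tree, which by Hodges' argument
-- contains an instance of the order property once it is high enough. What counts as
-- large depends on the size of the set split, so that goodness can be demanded at a scale far below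
-- the density of X.

module Submission where

open import Defs
open import Algebra.Bundles using (AbelianGroup)
open import Data.Fin.Subset using (Subset; _∈_; ∁)
open import Data.Nat.Base using (ℕ; NonZero; _≥_)
open import Data.Nat.Primality using (Prime)
open import Data.Product.Base using (Σ-syntax)
open import Data.Sum.Base using (_⊎_)
open import Data.Bool.Base using (Bool; true; false; _∧_; not; T)
open import Data.Bool.Properties using (T-∧; T-≡; T?)
open import Data.Fin.Base using (Fin; toℕ; punchIn)
open import Data.Fin.Permutation using (permutation)
open import Data.Fin.Properties
  using (toℕ-fromℕ<; toℕ-injective; toℕ<n; toℕ≤n; _≟_; any?; all?; ¬∀⟶∃¬; punchInᵢ≢i)
open import Data.Fin.Subset using (∣_∣; inside; outside)
import Data.Integer.Base as ℤ
import Data.Integer.Properties as ℤ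
open import Data.Nat.Base as ℕ using (zero; suc; _+_; _*_; _∸_; _%_; z≤n; s≤s)
open import Data.Nat.Coprimality using (coprime-Bézout; prime⇒coprime)
open import Data.Nat.DivMod
  using (_mod_; m%n<n; %-distribˡ-+; %-distribˡ-*; m<n⇒m%n≡m; [m+kn]%n≡m%n)
open import Data.Nat.GCD using (module Bézout)
import Data.Nat.Properties as ℕ
open import Data.Nat.Tactic.RingSolver using (solve-∀)
open import Data.Product.Base using (_×_; _,_; ∃-syntax; proj₁; proj₂; map₂)
import Data.Rational.Base as ℚ
open import Data.Rational.Base using (0ℚ)
import Data.Rational.Properties as ℚ
import Data.Rational.Unnormalised.Base as ℚᵘ
import Data.Rational.Unnormalised.Properties as ℚᵘ
open import Data.Sum.Base using (inj₁; inj₂) renaming (map to map⊎)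
open import Data.Unit.Base using (tt)
open import Data.Vec.Base using ([]; _∷_; lookup)
open import Data.Vec.Functional using (removeAt)
open import Data.Vec.Properties using (lookup-map; []=⇒lookup; lookup⇒[]=)
open import Function.Base using (_∘_; const)
open import Function.Bundles using (_⇔_; mk⇔; module Equivalence)
open import Level using (0ℓ)
open import Relation.Binary.Core using (REL)
import Relation.Binary.Definitions as B
open import Relation.Binary.Definitions using (tri<; tri≈; tri>)
open import Relation.Binary.PropositionalEquality
open import Relation.Nullary using (¬_; yes; no; contradiction; ¬?)
open import Relation.Nullary.Decidable using (_×-dec_; _⊎-dec_)
open import Relation.Unary using (Pred; Decidable; _∩_; _⊆_; U; Satisfiable) renaming (∁ to ∁ᵖ)

open import Algebra.Properties.CommutativeMonoid.Sum ℕ.+-0-commutativeMonoid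
  using (sum; sum-cong-≗; ∑-comm; ∑-distrib-+; sum-permute; sum-remove)
open import Algebra.Properties.Semiring.Sum ℕ.+-*-semiring using (*-distribˡ-sum; *-distribʳ-sum)

-- Hodges' argument: from trees to half-graphs

snoc : {Z : Set} → ℕ → (ℕ → Z) → Z → ℕ → Z
snoc m f z i with i ℕ.<? m
... | yes _ = f i
... | no  _ = z

snoc-< : {Z : Set} {m : ℕ} (f : ℕ → Z) (z : Z) {i : ℕ} → i ℕ.< m → snoc m f z i ≡ f i
snoc-< {m = m} f z {i} i<m with i ℕ.<? m
... | yes _   = refl
... | no  i≮m = contradiction i<m i≮m

snoc-last : {Z : Set} (m : ℕ) (f : ℕ → Z) (z : Z) → snoc m f z m ≡ z
snoc-last m f z with m ℕ.<? m
... | yes m<m = contradiction m<m (ℕ.<-irrefl refl)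
... | no  _   = refl

cons : {Z : Set} → Z → (ℕ → Z) → ℕ → Z
cons z f zero    = z
cons z f (suc i) = f i

-- Closed form `2 ^ (m + 1) - 2`. Two-colouring a tree of height `height (suc m)` leaves a
-- monochromatic one of height `suc (height m)`: its root extends the ladder and a subtree below it
-- carries the induction.
height : ℕ → ℕ
height zero    = zero
height (suc m) = suc (height m) + suc (height m)

module Ladders {X Y : Set} (R : REL X Y 0ℓ) (R? : B.Decidable R) where

  -- A full binary tree with inner nodes y ∈ Q and leaves x ∈ S, in which the left
  -- subtree at y contains the leaves related to y.
  Tree : ℕ → Pred X 0ℓ → Pred Y 0ℓ → Set
  Tree zero    S Q = Satisfiable S
  Tree (suc n) S Q = ∃[ y ] Q y × Tree n (S ∩ λ x → R x y) Q × Tree n (S ∩ λ x → ¬ R x y) Q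

  leaf : ∀ n {S Q} → Tree n S Q → Satisfiable S
  leaf zero    t               = t
  leaf (suc n) (_ , _ , t , _) = let x , x∈S , _ = leaf n t in x , x∈S

  Tree-mono : ∀ n {S S′ Q} → S ⊆ S′ → Tree n S Q → Tree n S′ Q
  Tree-mono zero    S⊆S′ (x , x∈S)         = x , S⊆S′ x∈S
  Tree-mono (suc n) S⊆S′ (y , y∈Q , l , r) =
    y , y∈Q , Tree-mono n (λ (s , c) → S⊆S′ s , c) l , Tree-mono n (λ (s , c) → S⊆S′ s , c) r

  -- Induction on `m + n`. The root joins two subtrees that both yield its own colour; if one of
  -- them yields the other colour instead, that tree already has the full height required.
  Tree-ramsey : ∀ m n {S Q C} → Decidable C → Tree (m + n) S Q →
                Tree m S (Q ∩ C) ⊎ Tree n S (Q ∩ ∁ᵖ C)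
  Tree-ramsey zero    n       C? t = inj₁ (leaf n t)
  Tree-ramsey (suc m) zero    C? t = inj₂ (leaf (suc m + 0) t)
  Tree-ramsey (suc m) (suc n) {S} {Q} C? (y , y∈Q , l , r) with C? y
  ... | yes y∈C with Tree-ramsey m (suc n) C? l | Tree-ramsey m (suc n) C? r
  ...   | inj₁ l′ | inj₁ r′ = inj₁ (y , (y∈Q , y∈C) , l′ , r′)
  ...   | inj₂ l′ | _       = inj₂ (Tree-mono (suc n) proj₁ l′)
  ...   | inj₁ _  | inj₂ r′ = inj₂ (Tree-mono (suc n) proj₁ r′)
  Tree-ramsey (suc m) (suc n) {S} {Q} C? (y , y∈Q , l , r) | no y∉C
    with Tree-ramsey (suc m) n C? (subst (λ h → Tree h (S ∩ λ x → R x y) Q) (ℕ.+-suc m n) l)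
       | Tree-ramsey (suc m) n C? (subst (λ h → Tree h (S ∩ λ x → ¬ R x y) Q) (ℕ.+-suc m n) r)
  ... | inj₂ l′ | inj₂ r′ = inj₂ (y , (y∈Q , y∉C) , l′ , r′)
  ... | inj₁ l′ | _       = inj₁ (Tree-mono (suc m) proj₁ l′)
  ... | inj₂ _  | inj₁ r′ = inj₁ (Tree-mono (suc m) proj₁ r′)

  -- A half-graph with `m + 1` points `x` and `m` points `y`. The sequences are total on ℕ to ease
  -- extension at either end; values outside the range are arbitrary.
  record Ladder (m : ℕ) (S : Pred X 0ℓ) (Q : Pred Y 0ℓ) : Set where
    field
      x       : ℕ → X
      y       : ℕ → Y
      x∈S     : ∀ {i} → i ℕ.≤ m → S (x i)
      y∈Q     : ∀ {j} → j ℕ.< m → Q (y j)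
      related : ∀ {i j} → i ℕ.≤ m → j ℕ.< m → R (x i) (y j) ⇔ i ℕ.≤ j

  -- `a` is related to every later `y`, and `b` to no later `x`, as index 0 demands.
  Ladder-cons : ∀ {m S Q a b} → S a → Q b → R a b →
                Ladder m (S ∩ λ x → ¬ R x b) (Q ∩ R a) → Ladder (suc m) S Q
  Ladder-cons {m} {S} {Q} {a} {b} a∈S b∈Q Rab L = record
    { x       = cons a x
    ; y       = cons b y
    ; x∈S     = λ { {zero} _ → a∈S ; {suc i} (s≤s i≤m) → proj₁ (x∈S i≤m) }
    ; y∈Q     = λ { {zero} _ → b∈Q ; {suc j} (s≤s j<m) → proj₁ (y∈Q j<m) }
    ; related = rel
    }
    where
    open Ladder L
    rel : ∀ {i j} → i ℕ.≤ suc m → j ℕ.< suc m → R (cons a x i) (cons b y j) ⇔ i ℕ.≤ j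
    rel {zero}  {zero}  _         _         = mk⇔ (const z≤n) (const Rab)
    rel {zero}  {suc j} _         (s≤s j<m) = mk⇔ (const z≤n) (const (proj₂ (y∈Q j<m)))
    rel {suc i} {zero}  (s≤s i≤m) _         =
      mk⇔ (λ Rxb → contradiction Rxb (proj₂ (x∈S i≤m))) (λ ())
    rel {suc i} {suc j} (s≤s i≤m) (s≤s j<m) =
      let open Equivalence (related i≤m j<m) in mk⇔ (s≤s ∘ to) (from ∘ ℕ.s≤s⁻¹)

  Ladder-snoc : ∀ {m S Q a b} → S a → Q b → ¬ R a b →
                Ladder m (S ∩ λ x → R x b) (Q ∩ λ y → ¬ R a y) → Ladder (suc m) S Q
  Ladder-snoc {m} {S} {Q} {a} {b} a∈S b∈Q ¬Rab L = record
    { x = x′ ; y = y′ ; x∈S = x′∈S ; y∈Q = y′∈Q ; related = rel }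
    where
    open Ladder L
    -- The index of `a` exceeds that of `b` by one, so `a` lies beyond every `y` and is related to
    -- none, while all earlier `x` are related to `b`.
    x′ = snoc (suc m) x a
    y′ = snoc m y b

    x′∈S : ∀ {i} → i ℕ.≤ suc m → S (x′ i)
    x′∈S i≤1+m with ℕ.m≤n⇒m<n∨m≡n i≤1+m
    ... | inj₁ i<1+m = subst S (sym (snoc-< x a i<1+m)) (proj₁ (x∈S (ℕ.s≤s⁻¹ i<1+m)))
    ... | inj₂ refl  = subst S (sym (snoc-last (suc m) x a)) a∈S

    y′∈Q : ∀ {j} → j ℕ.< suc m → Q (y′ j)
    y′∈Q j<1+m with ℕ.m<1+n⇒m<n∨m≡n j<1+m
    ... | inj₁ j<m  = subst Q (sym (snoc-< y b j<m)) (proj₁ (y∈Q j<m))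
    ... | inj₂ refl = subst Q (sym (snoc-last m y b)) b∈Q

    rel : ∀ {i j} → i ℕ.≤ suc m → j ℕ.< suc m → R (x′ i) (y′ j) ⇔ i ℕ.≤ j
    rel i≤1+m j<1+m with ℕ.m≤n⇒m<n∨m≡n i≤1+m | ℕ.m<1+n⇒m<n∨m≡n j<1+m
    ... | inj₁ i<1+m | inj₁ j<m rewrite snoc-< x a i<1+m | snoc-< y b j<m =
      related (ℕ.s≤s⁻¹ i<1+m) j<m
    ... | inj₁ i<1+m | inj₂ refl rewrite snoc-< x a i<1+m | snoc-last m y b =
      mk⇔ (const (ℕ.s≤s⁻¹ i<1+m)) (const (proj₂ (x∈S (ℕ.s≤s⁻¹ i<1+m))))
    ... | inj₂ refl | inj₁ j<m rewrite snoc-last (suc m) x a | snoc-< y b j<m =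
      mk⇔ (λ Ray → contradiction Ray (proj₂ (y∈Q j<m)))
          (λ m<j → contradiction (ℕ.<-trans m<j j<m) (ℕ.<-irrefl refl))
    ... | inj₂ refl | inj₂ refl rewrite snoc-last (suc m) x a | snoc-last m y b =
      mk⇔ (λ Rab → contradiction Rab ¬Rab) (λ m<m → contradiction m<m (ℕ.<-irrefl refl))

  -- Colour the nodes y by whether R a y, for some leaf a.  If the subtree is related to a, then a
  -- and the root b form the first pair of the ladder; otherwise they form the last pair.
  Tree⇒Ladder : Y → ∀ m {S Q} → Tree (height m) S Q → Ladder m S Q
  Tree⇒Ladder y₀ zero    (a , a∈S) = record
    { x = const a ; y = const y₀ ; x∈S = const a∈S ; y∈Q = λ () ; related = λ _ () }
  Tree⇒Ladder y₀ (suc m) t with leaf (height (suc m)) t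
  ... | a , a∈S with Tree-ramsey (suc (height m)) (suc (height m)) (R? a) t
  ...   | inj₁ (b , (b∈Q , Rab) , _ , r)  = Ladder-cons a∈S b∈Q Rab (Tree⇒Ladder y₀ m r)
  ...   | inj₂ (b , (b∈Q , ¬Rab) , l , _) = Ladder-snoc a∈S b∈Q ¬Rab (Tree⇒Ladder y₀ m l)

-- Finite sums and cardinalities

sum-mono : ∀ {n} {f g : Fin n → ℕ} → (∀ i → f i ℕ.≤ g i) → sum f ℕ.≤ sum g
sum-mono {zero}  f≤g = z≤n
sum-mono {suc n} f≤g = ℕ.+-mono-≤ (f≤g Fin.zero) (sum-mono (f≤g ∘ Fin.suc))

sum-const : ∀ n c → sum {n} (const c) ≡ n * c
sum-const zero    c = refl
sum-const (suc n) c = cong (c +_) (sum-const n c)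

sum≤ : ∀ {n} {f : Fin n → ℕ} {c} → (∀ i → f i ℕ.≤ c) → sum f ℕ.≤ n * c
sum≤ {n} {c = c} f≤c = ℕ.≤-trans (sum-mono f≤c) (ℕ.≤-reflexive (sum-const n c))

sum≤-except : ∀ {n} (f : Fin n → ℕ) (i : Fin n) {c} → (∀ j → j ≢ i → f j ℕ.≤ c) →
              sum f ℕ.≤ f i + n * c
sum≤-except {suc n} f i {c} f≤c = begin
  sum f                      ≡⟨ sum-remove f ⟩
  f i + sum (removeAt f i)   ≤⟨ ℕ.+-monoʳ-≤ (f i) (sum≤ λ j → f≤c (punchIn i j) (punchInᵢ≢i i j)) ⟩
  f i + n * c                ≤⟨ ℕ.+-monoʳ-≤ (f i) (ℕ.m≤n+m (n * c) c) ⟩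
  f i + suc n * c            ∎
  where open ℕ.≤-Reasoning

χ : Bool → ℕ
χ false = 0
χ true  = 1

χ-∧ : ∀ a b → χ (a ∧ b) ≡ χ a * χ b
χ-∧ false b = refl
χ-∧ true  b = sym (ℕ.*-identityˡ (χ b))

# : ∀ {n} → (Fin n → Bool) → ℕ
# X = sum (χ ∘ X)

#>0⇒∃ : ∀ {n} (X : Fin n → Bool) → 0 ℕ.< # X → ∃[ x ] T (X x)
#>0⇒∃ {n} X 0<#X with any? (T? ∘ X)
... | yes x∈X = x∈X
... | no  X≡∅ = contradiction (ℕ.≤-trans (sum≤ χ≤0) (ℕ.≤-reflexive (ℕ.*-zeroʳ n))) (ℕ.<⇒≱ 0<#X)
  where
  χ≤0 : ∀ i → χ (X i) ℕ.≤ 0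
  χ≤0 i with X i in eq
  ... | false = z≤n
  ... | true  = contradiction (i , subst T (sym eq) tt) X≡∅

-- If a subset of relative size at least 1/N splits into two parts of relative size at least 1/F N
-- within it, then both parts have relative size at least 1/(F N * N) in the ambient group. The
-- threshold exceeds every F N that occurs in h such splittings.
threshold : (ℕ → ℕ) → ℕ → ℕ → ℕ
threshold F zero    N = 0
threshold F (suc h) N = suc (F N) + threshold F h (F N * N)

-- Double counting over translates

module Translates (n : ℕ) .{{_ : NonZero n}} where
  open AbelianGroup (ℤ/ n) using (assoc; comm; identityʳ; inverseˡ; inverseʳ)
  infixl 6 _+ᴳ_
  _+ᴳ_ = _⊕_ n

  FinSet = Fin n → Bool

  sum-shift : ∀ (f : Fin n → ℕ) d → sum (λ x → f (x +ᴳ d)) ≡ sum f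
  sum-shift f d = sym (sum-permute f (permutation (_+ᴳ d) (_+ᴳ ⊖_ n d)
    (λ x → trans (assoc x (⊖_ n d) d) (trans (cong (x +ᴳ_) (inverseˡ d)) (identityʳ x)))
    (λ x → trans (assoc x d (⊖_ n d)) (trans (cong (x +ᴳ_) (inverseʳ d)) (identityʳ x)))))

  -- X ∩ (Y − b)
  meet : FinSet → FinSet → Fin n → FinSet
  meet X Y b x = X x ∧ Y (x +ᴳ b)

  -- Both sides count the pairs in `X` × `Y`: the pair with difference `b` is counted by its first
  -- entry in `meet X Y b`.
  sum-#meet : ∀ X Y → sum (# ∘ meet X Y) ≡ # X * # Y
  sum-#meet X Y = begin
    sum (λ b → sum (λ x → χ (X x ∧ Y (x +ᴳ b))))        ≡⟨ ∑-comm (λ b x → χ (meet X Y b x)) ⟩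
    sum (λ x → sum (λ b → χ (X x ∧ Y (x +ᴳ b))))        ≡⟨ sum-cong-≗ inner ⟩
    sum (λ x → χ (X x) * # Y)                           ≡⟨ *-distribʳ-sum (# Y) (χ ∘ X) ⟨
    # X * # Y                                           ∎
    where
    open ≡-Reasoning
    inner : ∀ x → sum (λ b → χ (X x ∧ Y (x +ᴳ b))) ≡ χ (X x) * # Y
    inner x = begin
      sum (λ b → χ (X x ∧ Y (x +ᴳ b)))     ≡⟨ sum-cong-≗ (λ b →
        trans (χ-∧ (X x) _) (cong (λ z → χ (X x) * χ (Y z)) (comm x b))) ⟩
      sum (λ b → χ (X x) * χ (Y (b +ᴳ x))) ≡⟨ *-distribˡ-sum (χ (X x)) (λ b → χ (Y (b +ᴳ x))) ⟨
      χ (X x) * sum (λ b → χ (Y (b +ᴳ x))) ≡⟨ cong (χ (X x) *_) (sum-shift (χ ∘ Y) x) ⟩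
      χ (X x) * # Y                        ∎

  #meet≤⇒# : ∀ X Y M → 0 ℕ.< # X → (∀ b → M * # (meet X Y b) ℕ.≤ # X) → M * # Y ℕ.≤ n
  #meet≤⇒# X Y M 0<#X small = ℕ.*-cancelʳ-≤ (M * # Y) n (# X) {{ℕ.>-nonZero 0<#X}} (begin
    M * # Y * # X                   ≡⟨ ℕ.*-assoc M (# Y) (# X) ⟩
    M * (# Y * # X)                 ≡⟨ cong (M *_) (ℕ.*-comm (# Y) (# X)) ⟩
    M * (# X * # Y)                 ≡⟨ cong (M *_) (sum-#meet X Y) ⟨
    M * sum (# ∘ meet X Y)          ≡⟨ *-distribˡ-sum M (# ∘ meet X Y) ⟩
    sum (λ b → M * # (meet X Y b))  ≤⟨ sum≤ small ⟩
    n * # X                         ∎)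
    where open ℕ.≤-Reasoning

  -- Otherwise summing `M * # (meet X X d)` over all `d` gives at most `M * # X` from `d = 𝟘` and
  -- `2 * # X` from each other `d`. The total is `M * # X * # X`, so cancelling `# X` contradicts
  -- the size hypothesis.
  popular-difference : ∀ X M → 0 ℕ.< # X → M + n * 2 ℕ.< M * # X →
    ∃[ d ] d ≢ 𝟘 n × 2 * # X ℕ.< M * # (meet X X d)
  popular-difference X M 0<#X large
    with any? (λ d → ¬? (d ≟ 𝟘 n) ×-dec (2 * # X ℕ.<? M * # (meet X X d)))
  ... | yes p = p
  ... | no ¬p = contradiction bound (ℕ.<⇒≱ large)
    where
    open ℕ.≤-Reasoning
    meet≤ : ∀ x b → χ (meet X X b x) ℕ.≤ χ (X x)
    meet≤ x b with X x
    ... | false = z≤n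
    ... | true  with X (x +ᴳ b)
    ...   | false = z≤n
    ...   | true  = s≤s z≤n

    bound : M * # X ℕ.≤ M + n * 2
    bound = ℕ.*-cancelʳ-≤ (M * # X) (M + n * 2) (# X) {{ℕ.>-nonZero 0<#X}} (begin
      M * # X * # X                       ≡⟨ ℕ.*-assoc M (# X) (# X) ⟩
      M * (# X * # X)                     ≡⟨ cong (M *_) (sum-#meet X X) ⟨
      M * sum (# ∘ meet X X)              ≡⟨ *-distribˡ-sum M (# ∘ meet X X) ⟩
      sum (λ d → M * # (meet X X d))      ≤⟨ sum≤-except _ (𝟘 n) (λ d d≢𝟘 →
        ℕ.≮⇒≥ (λ big → ¬p (d , d≢𝟘 , big))) ⟩
      M * # (meet X X (𝟘 n)) + n * (2 * # X) ≤⟨ ℕ.+-monoˡ-≤ _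
        (ℕ.*-monoʳ-≤ M (sum-mono (λ x → meet≤ x (𝟘 n)))) ⟩
      M * # X + n * (2 * # X)             ≡⟨ cong (M * # X +_) (ℕ.*-assoc n 2 (# X)) ⟨
      M * # X + n * 2 * # X               ≡⟨ ℕ.*-distribʳ-+ (# X) M (n * 2) ⟨
      (M + n * 2) * # X                   ∎)

  -- Let `x` and `x + d` both lie in `X`. If `x + d + b` is in `Y`, then `x + d` is counted by the
  -- first term; if not, `x` is counted by the second.
  #meet-shift : ∀ X Y b d → # (meet X X d) ℕ.≤ # (meet X Y b) + # (meet X (not ∘ Y) (b +ᴳ d))
  #meet-shift X Y b d = begin
    # (meet X X d)                                                           ≤⟨ sum-mono pointwise ⟩
    sum (λ x → χ (meet X Y b (x +ᴳ d)) + χ (meet X (not ∘ Y) (b +ᴳ d) x))    ≡⟨ ∑-distrib-+ _ (χ ∘ meet X (not ∘ Y) (b +ᴳ d)) ⟩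
    sum (λ x → χ (meet X Y b (x +ᴳ d))) + # (meet X (not ∘ Y) (b +ᴳ d))      ≡⟨ cong (_+ # (meet X (not ∘ Y) (b +ᴳ d)))
        (sum-shift (χ ∘ meet X Y b) d) ⟩
    # (meet X Y b) + # (meet X (not ∘ Y) (b +ᴳ d))                           ∎
    where
    open ℕ.≤-Reasoning
    cases : ∀ u v w → χ (u ∧ v) ℕ.≤ χ (v ∧ w) + χ (u ∧ not w)
    cases false v     w     = z≤n
    cases true  false w     = z≤n
    cases true  true  false = s≤s z≤n
    cases true  true  true  = s≤s z≤n
    pointwise : ∀ x → χ (meet X X d x) ℕ.≤ χ (meet X Y b (x +ᴳ d)) + χ (meet X (not ∘ Y) (b +ᴳ d) x)
    pointwise x rewrite trans (cong (x +ᴳ_) (comm b d)) (sym (assoc x d b)) =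
      cases (X x) (X (x +ᴳ d)) (Y (x +ᴳ d +ᴳ b))

  -- Nonzero residues generate the group

  module _ (p : Prime n) where

    private
      toℕ-mod : ∀ m → toℕ (m mod n) ≡ m % n
      toℕ-mod m = toℕ-fromℕ< (m%n<n m n)

      cong-*% : ∀ a b c → a % n ≡ b % n → (a * c) % n ≡ (b * c) % n
      cong-*% a b c eq = trans (%-distribˡ-* a c n)
        (trans (cong (λ t → (t * (c % n)) % n) eq) (sym (%-distribˡ-* b c n)))

    inverse-mod : ∀ d .{{_ : NonZero d}} → d ℕ.< n → ∃[ m ] (m * d) % n ≡ 1 % n
    inverse-mod d d<n with coprime-Bézout (prime⇒coprime p d<n)
    ... | Bézout.-+ x y eq = y , trans (cong (_% n) (sym eq)) ([m+kn]%n≡m%n 1 x n)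
    -- Here `y * d` is -1 modulo `n`, so its square is 1; this keeps the inverse a natural number.
    ... | Bézout.+- x y eq = y * d * y , (begin
        (y * d * y * d) % n               ≡⟨ [m+kn]%n≡m%n (y * d * y * d) x n ⟨
        (y * d * y * d + x * n) % n       ≡⟨ cong (λ t → (y * d * y * d + t) % n) eq ⟨
        (y * d * y * d + (1 + y * d)) % n ≡⟨ cong (_% n) (square y d) ⟩
        (1 + (1 + y * d) * (y * d)) % n   ≡⟨ cong (λ t → (1 + t * (y * d)) % n) eq ⟩
        (1 + x * n * (y * d)) % n         ≡⟨ cong (λ t → (1 + t) % n) (rearrange x n (y * d)) ⟩
        (1 + (x * (y * d)) * n) % n       ≡⟨ [m+kn]%n≡m%n 1 (x * (y * d)) n ⟩
        1 % n                             ∎)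
      where
      open ≡-Reasoning
      square : ∀ y d → y * d * y * d + (1 + y * d) ≡ 1 + (1 + y * d) * (y * d)
      square = solve-∀
      rearrange : ∀ x n z → x * n * z ≡ x * z * n
      rearrange = solve-∀

    -- With `m` inverse to `d` modulo `n` and `s` representing `c - b`, exactly `m * s` translations
    -- by `d` lead from `b` to `c`.
    translation-induction : ∀ (P : Pred (Fin n) 0ℓ) {d} → d ≢ 𝟘 n → (∀ b → P b → P (b +ᴳ d)) →
                            ∀ b → P b → ∀ c → P c
    translation-induction P {d} d≢𝟘 step b b∈P c = subst P reach (iterate (m * s))
      where
      δ = toℕ d
      β = toℕ b
      γ = toℕ c
      s = γ + (n ∸ β)

      instance
        δ≢0 : NonZero δ
        δ≢0 = ℕ.≢-nonZero λ δ≡0 → d≢𝟘 (toℕ-injective (trans δ≡0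
          (sym (trans (toℕ-mod 0) (m<n⇒m%n≡m (ℕ.>-nonZero⁻¹ n))))))

      m = proj₁ (inverse-mod δ (toℕ<n d))

      iterate : ∀ k → P ((β + k * δ) mod n)
      iterate zero    = subst P (toℕ-injective (begin
        toℕ b               ≡⟨ m<n⇒m%n≡m (toℕ<n b) ⟨
        β % n               ≡⟨ cong (_% n) (ℕ.+-identityʳ β) ⟨
        (β + 0) % n         ≡⟨ toℕ-mod (β + 0) ⟨
        toℕ ((β + 0) mod n) ∎)) b∈P
        where open ≡-Reasoning
      iterate (suc k) = subst P (toℕ-injective (begin
        toℕ ((β + k * δ) mod n +ᴳ d)        ≡⟨ toℕ-mod _ ⟩
        (toℕ ((β + k * δ) mod n) + δ) % n   ≡⟨ cong (λ t → (t + δ) % n) (toℕ-mod (β + k * δ)) ⟩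
        ((β + k * δ) % n + δ) % n           ≡⟨ cong (λ t → ((β + k * δ) % n + t) % n) (m<n⇒m%n≡m (toℕ<n d)) ⟨
        ((β + k * δ) % n + δ % n) % n       ≡⟨ %-distribˡ-+ (β + k * δ) δ n ⟨
        (β + k * δ + δ) % n                 ≡⟨ cong (_% n)
          (trans (ℕ.+-assoc β (k * δ) δ) (cong (β +_) (ℕ.+-comm (k * δ) δ))) ⟩
        (β + suc k * δ) % n                 ≡⟨ toℕ-mod (β + suc k * δ) ⟨
        toℕ ((β + suc k * δ) mod n)         ∎)) (step _ (iterate k))
        where open ≡-Reasoning

      reach : (β + m * s * δ) mod n ≡ c
      reach = toℕ-injective (begin
        toℕ ((β + m * s * δ) mod n)      ≡⟨ toℕ-mod _ ⟩
        (β + m * s * δ) % n              ≡⟨ cong (λ t → (β + t) % n) (rearrange m s δ) ⟩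
        (β + m * δ * s) % n              ≡⟨ %-distribˡ-+ β (m * δ * s) n ⟩
        (β % n + (m * δ * s) % n) % n    ≡⟨ cong (λ t → (β % n + t) % n)
          (cong-*% (m * δ) 1 s (proj₂ (inverse-mod δ (toℕ<n d)))) ⟩
        (β % n + (1 * s) % n) % n        ≡⟨ %-distribˡ-+ β (1 * s) n ⟨
        (β + 1 * (γ + (n ∸ β))) % n      ≡⟨ cong (_% n) (regroup β γ (n ∸ β)) ⟩
        (γ + (β + (n ∸ β))) % n          ≡⟨ cong (λ t → (γ + t) % n) (ℕ.m+[n∸m]≡n (toℕ≤n b)) ⟩
        (γ + n) % n                      ≡⟨ cong (λ t → (γ + t) % n) (ℕ.*-identityˡ n) ⟨
        (γ + 1 * n) % n                  ≡⟨ [m+kn]%n≡m%n γ 1 n ⟩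
        γ % n                            ≡⟨ m<n⇒m%n≡m (toℕ<n c) ⟩
        toℕ c                            ∎)
        where
        open ≡-Reasoning
        rearrange : ∀ m s δ → m * s * δ ≡ m * δ * s
        rearrange = solve-∀
        regroup : ∀ β γ t → β + 1 * (γ + t) ≡ γ + (β + t)
        regroup = solve-∀

  -- Good sets

  -- The average of `A` over the translate of `X` by `b` is within `1/M` of 0 or of 1.
  GoodAt : FinSet → FinSet → ℕ → Fin n → Set
  GoodAt A X M b = M * # (meet X A b) ℕ.≤ # X ⊎ M * # (meet X (not ∘ A) b) ℕ.≤ # X

  goodAt? : ∀ A X M → Decidable (GoodAt A X M)
  goodAt? A X M b = M * # (meet X A b) ℕ.≤? # X ⊎-dec M * # (meet X (not ∘ A) b) ℕ.≤? # X

  Good : FinSet → FinSet → ℕ → Set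
  Good A X M = ∀ b → GoodAt A X M b

  Good⇒small : Prime n → ∀ A X M → Good A X M → 0 ℕ.< # X → M + n * 2 ℕ.< M * # X →
               M * # A ℕ.≤ n ⊎ M * # (not ∘ A) ℕ.≤ n
  Good⇒small n-prime A X M good 0<#X large with any? (λ b → M * # (meet X A b) ℕ.≤? # X)
  ... | no ¬small = inj₂ (#meet≤⇒# X (not ∘ A) M 0<#X λ b → case-no b (good b))
    where
    case-no : ∀ b → GoodAt A X M b → M * # (meet X (not ∘ A) b) ℕ.≤ # X
    case-no b (inj₁ small)  = contradiction (b , small) ¬small
    case-no b (inj₂ small′) = small′
  ... | yes (b₀ , small₀) with popular-difference X M 0<#X large
  ...   | d , d≢𝟘 , popular = inj₁ (#meet≤⇒# X A M 0<#X
            (translation-induction n-prime (λ b → M * # (meet X A b) ℕ.≤ # X) d≢𝟘 step b₀ small₀))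
    where
    open ℕ.≤-Reasoning
    step : ∀ b → M * # (meet X A b) ℕ.≤ # X → M * # (meet X A (b +ᴳ d)) ℕ.≤ # X
    step b small with good (b +ᴳ d)
    ... | inj₁ small⁺ = small⁺
    -- Averages at opposite ends would bound the overlap of `X` with its translate by two
    -- exceptional sets of size at most `# X / M`, too few for a popular difference.
    ... | inj₂ small⁻ = contradiction (begin
      M * # (meet X X d)                                              ≤⟨ ℕ.*-monoʳ-≤ M (#meet-shift X A b d) ⟩
      M * (# (meet X A b) + # (meet X (not ∘ A) (b +ᴳ d)))            ≡⟨ ℕ.*-distribˡ-+ M (# (meet X A b)) _ ⟩
      M * # (meet X A b) + M * # (meet X (not ∘ A) (b +ᴳ d))          ≤⟨ ℕ.+-mono-≤ small small⁻ ⟩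
      # X + # X                                                       ≡⟨ cong (# X +_) (ℕ.+-identityʳ (# X)) ⟨
      2 * # X                                                         ∎) (ℕ.<⇒≱ popular)

  -- Splitting a set into a tree

  module Splitting (A : FinSet) where
    R : Fin n → Fin n → Set
    R x b = T (A (x +ᴳ b))

    open Ladders R (λ x b → T? (A (x +ᴳ b))) public

    -- `n ≤ # X * N` says that `X` has density at least `1/N`. A translate at which `X` is not good
    -- supplies the root, and the two parts it cuts off are dense enough for the induction on `h`.
    good-or-tree : ∀ (F : ℕ → ℕ) h N X → threshold F h N ℕ.≤ n → n ℕ.≤ # X * N →
      (∃[ Y ] ∃[ N′ ] F N′ ℕ.< n × n ℕ.≤ # Y * N′ × Good A Y (F N′)) ⊎ Tree h (T ∘ X) U
    good-or-tree F zero    N X _ dense =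
      inj₂ (#>0⇒∃ X (ℕ.n≢0⇒n>0 λ #X≡0 →
        ℕ.<⇒≱ (ℕ.>-nonZero⁻¹ n) (subst (λ t → n ℕ.≤ t * N) #X≡0 dense)))
    good-or-tree F (suc h) N X n-large dense
      with all? (goodAt? A X (F N))
    ... | yes good = inj₁ (X , N , ℕ.≤-trans (ℕ.m≤m+n _ _) n-large , dense , good)
    ... | no ¬good = split (¬∀⟶∃¬ n _ (goodAt? A X (F N)) ¬good)
      where
      dense′ : ∀ B b → ¬ (F N * # (meet X B b) ℕ.≤ # X) → n ℕ.≤ # (meet X B b) * (F N * N)
      dense′ B b ¬small = begin
        n                            ≤⟨ dense ⟩
        # X * N                      ≤⟨ ℕ.*-monoˡ-≤ N (ℕ.≰⇒≥ ¬small) ⟩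
        F N * # (meet X B b) * N     ≡⟨ cong (_* N) (ℕ.*-comm (F N) _) ⟩
        # (meet X B b) * F N * N     ≡⟨ ℕ.*-assoc (# (meet X B b)) (F N) N ⟩
        # (meet X B b) * (F N * N)   ∎
        where open ℕ.≤-Reasoning

      n-large′ : threshold F h (F N * N) ℕ.≤ n
      n-large′ = ℕ.≤-trans (ℕ.m≤n+m _ (suc (F N))) n-large

      split : ∃[ b ] ¬ GoodAt A X (F N) b →
        (∃[ Y ] ∃[ N′ ] F N′ ℕ.< n × n ℕ.≤ # Y * N′ × Good A Y (F N′)) ⊎ Tree (suc h) (T ∘ X) U
      split (b , ¬small)
        with good-or-tree F h (F N * N) (meet X A b) n-large′ (dense′ A b (¬small ∘ inj₁))
           | good-or-tree F h (F N * N) (meet X (not ∘ A) b) n-large′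
               (dense′ (not ∘ A) b (¬small ∘ inj₂))
      ... | inj₁ good | _         = inj₁ good
      ... | inj₂ _    | inj₁ good = inj₁ good
      ... | inj₂ l    | inj₂ r    = inj₂ (b , tt ,
        Tree-mono h (λ {x} → Equivalence.to (T-∧ {X x})) l ,
        Tree-mono h (λ {x} → map₂ (T-not (A (x +ᴳ b))) ∘ Equivalence.to (T-∧ {X x})) r)
        where
        T-not : ∀ u → T (not u) → ¬ T u
        T-not false _ ()

    -- In `F` the factor `4 * N` offsets the density of `X`, giving `M + n * 2 < M * # X` once
    -- `M < n`; the factor `E` makes `M` at least `E`. The splitting starts from the whole group, of
    -- density 1.
    unordered⇒small : Prime n → ∀ E .{{_ : NonZero E}} k → let F = λ N → 4 * N * E in
      threshold F (height k) 1 ℕ.≤ n → ¬ Ladder k U U → E * # A ℕ.≤ n ⊎ E * # (not ∘ A) ℕ.≤ n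
    unordered⇒small n-prime E k n-large ¬ladder
      with good-or-tree (λ N → 4 * N * E) (height k) 1 (const true) n-large
             (ℕ.≤-reflexive (sym (trans (ℕ.*-identityʳ _) (trans (sum-const n 1) (ℕ.*-identityʳ n)))))
    ... | inj₂ tree = contradiction (Tree⇒Ladder (𝟘 n) k (Tree-mono (height k) _ tree)) ¬ladder
    ... | inj₁ (X , N , M<n , dense , good) =
      map⊎ (weaken A) (weaken (not ∘ A)) (Good⇒small n-prime A X M good 0<#X large)
      where
      open ℕ.≤-Reasoning
      M = 4 * N * E

      0<n : 0 ℕ.< n
      0<n = ℕ.>-nonZero⁻¹ n

      0<#X : 0 ℕ.< # X
      0<#X = ℕ.n≢0⇒n>0 λ #X≡0 → ℕ.<⇒≱ 0<n (subst (λ t → n ℕ.≤ t * N) #X≡0 dense)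

      0<N : 0 ℕ.< N
      0<N = ℕ.n≢0⇒n>0 λ N≡0 → ℕ.<⇒≱ 0<n
        (ℕ.≤-trans dense (ℕ.≤-reflexive (trans (cong (# X *_) N≡0) (ℕ.*-zeroʳ (# X)))))

      weaken : ∀ B → M * # B ℕ.≤ n → E * # B ℕ.≤ n
      weaken B = ℕ.≤-trans (ℕ.*-monoˡ-≤ (# B) (ℕ.m≤n*m E (4 * N) {{ℕ.m*n≢0 4 N {{_}} {{ℕ.>-nonZero 0<N}}}}))

      large : M + n * 2 ℕ.< M * # X
      large = begin-strict
        M + n * 2              <⟨ ℕ.+-monoˡ-< (n * 2) M<n ⟩
        n + n * 2              ≤⟨ ℕ.m≤m+n (n + n * 2) n ⟩
        n + n * 2 + n          ≡⟨ four n ⟩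
        4 * n                  ≤⟨ ℕ.*-monoʳ-≤ 4 dense ⟩
        4 * (# X * N)          ≤⟨ ℕ.m≤m*n (4 * (# X * N)) E ⟩
        4 * (# X * N) * E      ≡⟨ regroup (# X) N E ⟩
        4 * N * E * # X        ∎
        where
        four : ∀ n → n + n * 2 + n ≡ 4 * n
        four = solve-∀
        regroup : ∀ x N E → 4 * (x * N) * E ≡ 4 * N * E * x
        regroup = solve-∀

-- From cardinalities to real densities

lower<upper : ∀ (x : ℝ) {q r} → ℝ.Lower x q → ℝ.Upper x r → q ℚ.< r
lower<upper x {q} {r} q<x x<r with ℚ.<-cmp q r
... | tri< q<r _ _  = q<r
... | tri≈ _ refl _ = contradiction (q<x , x<r) (ℝ.disjoint x q)
... | tri> _ _ r<q  =
  contradiction (q<x , Equivalence.from (ℝ.upper-rounded x q) (r , r<q , x<r)) (ℝ.disjoint x q)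

-- A positive rational is at least the reciprocal of its denominator.
/-≤-positive : ∀ q → 0ℚ ℚ.< q → ∀ a n .{{_ : NonZero n}} → ℚ.↧ₙ q * a ℕ.≤ n → ℤ.+ a ℚ./ n ℚ.≤ q
/-≤-positive q@(ℚ.mkℚ (ℤ.+ zero)    d-1 _) 0<q a n _ = contradiction (ℚ.positive 0<q) λ ()
/-≤-positive q@(ℚ.mkℚ ℤ.-[1+ _ ] d-1 _) 0<q a n _ = contradiction (ℚ.positive 0<q) λ ()
/-≤-positive q@(ℚ.mkℚ (ℤ.+ suc m) d-1 _) 0<q a (suc n-1) da≤n = ℚ.toℚᵘ-cancel-≤
  (ℚᵘ.≤-trans (ℚᵘ.≤-reflexive (ℚ.toℚᵘ-fromℚᵘ (ℚᵘ.mkℚᵘ (ℤ.+ a) n-1))) (ℚᵘ.*≤* (begin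
    ℤ.+ a ℤ.* ℤ.+ suc d-1      ≡⟨ ℤ.pos-* a (suc d-1) ⟨
    ℤ.+ (a * suc d-1)        ≤⟨ ℤ.+≤+ (ℕ.≤-trans (ℕ.≤-reflexive (ℕ.*-comm a (suc d-1)))
                                 (ℕ.≤-trans da≤n (ℕ.m≤m+n (suc n-1) (m * suc n-1)))) ⟩
    ℤ.+ (suc m * suc n-1)    ≡⟨ ℤ.pos-* (suc m) (suc n-1) ⟩
    ℤ.+ suc m ℤ.* ℤ.+ suc n-1  ∎)))
  where open ℤ.≤-Reasoning

#-lookup : ∀ {n} (A : Subset n) → # (lookup A) ≡ ∣ A ∣
#-lookup []            = refl
#-lookup (outside ∷ A) = #-lookup A
#-lookup (inside  ∷ A) = cong suc (#-lookup A)

corollary3 : ∀ (ε : ℝ) → 0ℝ < ε → ε < 1ℝ → ∀ (k : ℕ) → k ≥ 2 →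
    Σ[ p₀ ∈ ℕ ] ∀ (p : ℕ) .{{_ : NonZero p}} → Prime p → p ≥ p₀ →
    ∀ (A : Subset p) → Stable (AbelianGroup.group (ℤ/ p)) k (_∈ A) →
    density A ≤ ε ⊎ density (∁ A) ≤ ε
corollary3 ε (q , 0<q , q<ε) _ k _ = threshold (λ N → 4 * N * E) (height k) 1 , main
  where
  -- For the rational `q` between 0 and `ε` this gives `1/E ≤ q < ε`.
  E = ℚ.↧ₙ q

  main : ∀ (p : ℕ) .{{_ : NonZero p}} → Prime p → p ≥ threshold (λ N → 4 * N * E) (height k) 1 →
    ∀ (A : Subset p) → Stable (AbelianGroup.group (ℤ/ p)) k (_∈ A) →
    density A ≤ ε ⊎ density (∁ A) ≤ ε
  main p p-prime p-large A stable =
    map⊎ (density≤ε A ∘ subst (λ t → E * t ℕ.≤ p) (#-lookup A))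
         (density≤ε (∁ A) ∘ subst (λ t → E * t ℕ.≤ p)
            (trans (sum-cong-≗ (λ x → cong χ (sym (lookup-map x not A)))) (#-lookup (∁ A))))
         (unordered⇒small p-prime E k p-large ¬ladder)
    where
    open Translates p
    open Splitting (lookup A)

    ¬ladder : ¬ Ladder k U U
    -- Restricting both sequences to indices below `k` drops the last `x` of the ladder.
    ¬ladder L = stable (x ∘ toℕ , y ∘ toℕ , λ i j → mk⇔
      (λ ∈A → Equivalence.to (related (ℕ.<⇒≤ (toℕ<n i)) (toℕ<n j)) (Equivalence.from T-≡ ([]=⇒lookup ∈A)))
      (λ i≤j → lookup⇒[]= _ A (Equivalence.to T-≡ (Equivalence.from (related (ℕ.<⇒≤ (toℕ<n i)) (toℕ<n j)) i≤j))))
      where open Ladder L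

    density≤ε : ∀ (B : Subset p) → E * ∣ B ∣ ℕ.≤ p → density B ≤ ε
    -- A rational `r` separating `ε` from a larger density would satisfy `q < r < density B ≤ q`.
    density≤ε B small (r , ε<r , r<B) = ℚ.<-irrefl refl
      (ℚ.<-≤-trans (ℚ.<-trans (lower<upper ε q<ε ε<r) r<B) (/-≤-positive q 0<q ∣ B ∣ p small))
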